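{- Let $G$ be a connected, reduced bipartite graph with partite sets $A=\{a_1,\dots,a_m\}$ and $B$, where $m=|A|\le |B|$ and $m=2k$ with $k\ge 3$. Suppose the poset $P_A$ has height $h(P_A)=2$ and contains at least two disjoint chains of size two. Then $\mathcal{R}(G)\le k$.
   Context: $N(x)$ denotes the neighborhood of a vertex $x$. A graph is reduced if no two vertices have the same neighborhood. $P_A$ is the poset on $A$ given by $a\preceq b$ iff $N(a)\subseteq N(b)$ (the poset induced by the neighborhood inclusion graph of $G$ with respect to $A$). A chain is a set of pairwise comparable elements; the height $h(P_A)$ is the maximum size of a chain. Letters $x,y$ alternate in a word $w$ if the subsequence of $w$ consisting of occurrences of $x$ and $y$ is $xyxy\cdots$ or $yxyx\cdots$. A word $w$ over the vertex set of a graph (containing every vertex) represents the graph if two vertices are adjacent iff they alternate in $w$. A word is $k$-uniform if each letter occurs exactly $k$ times. $\mathcal{R}(G)$ is the least $k$ such that some $k$-uniform word represents $G$. -}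

module Defs where

open import Data.Nat using (ℕ; _≤_)
open import Data.Fin using (Fin)
import Data.Fin.Properties as FinP
open import Data.Bool using (Bool; T)
open import Data.Sum using (_⊎_; inj₁; inj₂)
import Data.Sum.Properties as SumP
open import Data.Product using (Σ; _×_; ∃; ∃-syntax)
open import Data.Empty using (⊥)
open import Data.List using (List; length; filter)
open import Data.List.Membership.Propositional using (_∈_; _∉_)
open import Data.List.Relation.Unary.Unique.Propositional using (Unique)
open import Data.List.Relation.Unary.Linked using (Linked)
open import Relation.Binary.PropositionalEquality using (_≡_; _≢_)
open import Relation.Binary.Definitions using (DecidableEquality)
open import Relation.Binary.Construct.Closure.ReflexiveTransitive using (Star)
open import Relation.Nullary.Decidable using (_⊎-dec_)
open import Function.Bundles using (_⇔_)

-- A bipartite graph with partite sets A = Fin m and B = Fin p is given by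
-- its edge relation E : Fin m → Fin p → Bool (E a b = true iff a ~ b).
-- Its vertex set is V m p = Fin m ⊎ Fin p (inj₁ = A-side, inj₂ = B-side).

V : ℕ → ℕ → Set
V m p = Fin m ⊎ Fin p

_≟V_ : ∀ {m p} → DecidableEquality (V m p)
_≟V_ = SumP.≡-dec FinP._≟_ FinP._≟_

Adj : ∀ {m p} → (Fin m → Fin p → Bool) → V m p → V m p → Set
Adj E (inj₁ a) (inj₂ b) = T (E a b)
Adj E (inj₂ b) (inj₁ a) = T (E a b)
Adj E (inj₁ _) (inj₁ _) = ⊥
Adj E (inj₂ _) (inj₂ _) = ⊥

Connected : ∀ {m p} → (Fin m → Fin p → Bool) → Set
Connected E = ∀ u v → Star (Adj E) u v

Reduced : ∀ {m p} → (Fin m → Fin p → Bool) → Set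
Reduced E = ∀ u v → (∀ w → Adj E u w ⇔ Adj E v w) → u ≡ v

_≼[_]_ : ∀ {m p} → Fin m → (Fin m → Fin p → Bool) → Fin m → Set
a ≼[ E ] a' = ∀ w → Adj E (inj₁ a) w → Adj E (inj₁ a') w

Comparable : ∀ {m p} → (Fin m → Fin p → Bool) → Fin m → Fin m → Set
Comparable E a a' = (a ≼[ E ] a') ⊎ (a' ≼[ E ] a)

IsChain : ∀ {m p} → (Fin m → Fin p → Bool) → List (Fin m) → Set
IsChain E c = Unique c × (∀ a a' → a ∈ c → a' ∈ c → Comparable E a a')

HeightA : ∀ {m p} → (Fin m → Fin p → Bool) → ℕ → Set
HeightA E h =
  (∃[ c ] (IsChain E c × length c ≡ h)) ×
  (∀ c → IsChain E c → length c ≤ h)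

TwoDisjoint2Chains : ∀ {m p} → (Fin m → Fin p → Bool) → Set
TwoDisjoint2Chains E =
  ∃[ c₁ ] ∃[ c₂ ] (IsChain E c₁ × length c₁ ≡ 2 × IsChain E c₂ × length c₂ ≡ 2
                    × (∀ a → a ∈ c₁ → a ∉ c₂))

Word : ℕ → ℕ → Set
Word m p = List (V m p)

occ : ∀ {m p} → V m p → Word m p → ℕ
occ x w = length (filter (_≟V x) w)

-- x and y alternate in w: the subsequence of occurrences of x and y has
-- no two equal consecutive letters (i.e. is xyxy⋯ or yxyx⋯)
Alternate : ∀ {m p} → V m p → V m p → Word m p → Set
Alternate x y w = Linked _≢_ (filter (λ z → (z ≟V x) ⊎-dec (z ≟V y)) w)

Represents : ∀ {m p} → (Fin m → Fin p → Bool) → Word m p → Set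
Represents E w =
  (∀ v → v ∈ w) ×
  (∀ x y → x ≢ y → (Adj E x y ⇔ Alternate x y w))

Uniform : ∀ {m p} → ℕ → Word m p → Set
Uniform j w = ∀ v → occ v w ≡ j

-- 𝓡(G) ≤ k : the least j admitting a j-uniform representing word is ≤ k,
-- i.e. some j ≤ k admits a j-uniform representing word
RLe : ∀ {m p} → (Fin m → Fin p → Bool) → ℕ → Set
RLe E k = ∃[ j ] (j ≤ k × ∃[ w ] (Uniform j w × Represents E w))

{-# OPTIONS --safe #-}
module Submission where

-- Split A into k pairs, the first two being the chains, and take the word
-- Z₁ M₁ Z₂ M₂ ⋯ Z_k M_k.  The zone Z_j contains the pair j twice and every
-- b once; M_j contains once every A-letter outside the pairs j and j + 1
-- (cyclically).  A letter a of pair j then alternates with b iff b lies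
-- between the two a's of Z_j.  A pair {p, q} in the pattern p q p q has a
-- gap for each of the four possibilities N(b) ∩ {p, q}, and a chain
-- N(u) ⊆ N(y) in the pattern y u u y lets b be placed on either side of
-- the centre whenever b is not adjacent to both.  These two free choices
-- of side, made according to the gap of b in Z₃, ensure that any two
-- B-letters appear in both orders within Z₁, Z₂, Z₃.

open import Defs
open import Data.Bool using (Bool; true; false; T; if_then_else_)
open import Data.Bool.Properties as Bool using (T-≡)
open import Data.Empty using (⊥; ⊥-elim)
open import Data.Fin using (Fin; suc; opposite)
open import Data.Fin.Patterns using (0F; 1F; 2F; 3F; 4F)
open import Data.Fin.Properties using (_≟_; all?)
open import Data.List using (List; []; _∷_; _++_; length; filter; map; reverse; allFin)
open import Data.List.Membership.DecPropositional using (_∈?_)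
open import Data.List.Membership.Propositional using (_∈_; find)
open import Data.List.Membership.Propositional.Properties using (∈-allFin; ∈-filter⁻; ∈-filter⁺; ∈-map⁺; ∈-map⁻; ∈-++⁺ˡ; ∈-++⁺ʳ)
open import Data.List.Membership.Propositional.Properties.WithK using (unique∧set⇒bag)
open import Data.List.Properties using (filter-++; filter-≐; filter-accept; filter-reject; filter-none; map-++; unfold-reverse; reverse-map; length-++; ++-identityʳ; length-tabulate; length-map; ++-assoc; filter-all; map-∘)
open import Data.List.Relation.Binary.BagAndSetEquality using (∼bag⇒↭)
open import Data.List.Relation.Binary.Permutation.Propositional.Properties using (↭-length)
open import Data.List.Relation.Unary.All as All using (All; []; _∷_)
import Data.List.Relation.Unary.All.Properties as AllP
open import Data.List.Relation.Unary.AllPairs using (AllPairs; []; _∷_)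
import Data.List.Relation.Unary.AllPairs.Properties as AllPairsP
open import Data.List.Relation.Unary.Any using (here; there; Any)
open import Data.List.Relation.Unary.Linked as Linked using (Linked; []; [-]; _∷_; linked?)
open import Data.List.Relation.Unary.Linked.Properties using () renaming (map⁻ to Linked-map⁻)
open import Data.List.Relation.Unary.Unique.Propositional using (Unique)
import Data.List.Relation.Unary.Unique.Propositional.Properties as UniqueP
open import Data.List.Relation.Unary.Unique.Propositional.Properties using (allFin⁺)
open import Data.Nat using (ℕ; zero; suc; _+_; _≤_; _*_; s≤s)
open import Data.Nat.Properties using (+-assoc; +-comm; +-cancelʳ-≡; ≤-refl; suc-injective; *-suc)
open import Data.Product using (_×_; _,_; proj₁; proj₂; ∃-syntax)
open import Data.Sum as Sum using (_⊎_; inj₁; inj₂; [_,_]′)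
open import Function using (_∘_; id)
open import Function.Bundles using (_⇔_; mk⇔; Equivalence)
open import Relation.Binary.PropositionalEquality using (_≡_; _≢_; refl; sym; trans; cong; cong₂; subst; module ≡-Reasoning)
open import Relation.Nullary using (¬_; Dec; yes; no; does; contradiction)
open import Relation.Nullary.Decidable using (_⊎-dec_; _×-dec_; ¬?; from-yes; dec-true; dec-false)
open import Relation.Unary using (Decidable)

-- Restriction of lists and alternation.

module _ {A B : Set} {P : B → Set} (P? : Decidable P) (f : A → B) where

  filter-map : ∀ xs → filter P? (map f xs) ≡ map f (filter (P? ∘ f) xs)
  filter-map [] = refl
  filter-map (x ∷ xs) with does (P? (f x))
  ... | true  = cong (f x ∷_) (filter-map xs)
  ... | false = filter-map xs

module _ {A : Set} {P : A → Set} (P? : Decidable P) where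

  filter-comm : {Q : A → Set} (Q? : Decidable Q) → ∀ xs →
                filter P? (filter Q? xs) ≡ filter Q? (filter P? xs)
  filter-comm Q? [] = refl
  filter-comm Q? (x ∷ xs) with does (P? x) in p | does (Q? x) in q
  ... | true  | true  rewrite p | q = cong (x ∷_) (filter-comm Q? xs)
  ... | true  | false rewrite q = filter-comm Q? xs
  ... | false | true  rewrite p = filter-comm Q? xs
  ... | false | false = filter-comm Q? xs

  filter-reverse : ∀ xs → filter P? (reverse xs) ≡ reverse (filter P? xs)
  filter-reverse [] = refl
  filter-reverse (x ∷ xs)
    rewrite unfold-reverse x xs | filter-++ P? (reverse xs) (x ∷ []) | filter-reverse xs
    with does (P? x)
  ... | true  = sym (unfold-reverse x (filter P? xs))
  ... | false = ++-identityʳ _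

  filter-single : ∀ {x xs} → Unique xs → x ∈ xs → P x →
                  (∀ {z} → z ∈ xs → P z → z ≡ x) → filter P? xs ≡ x ∷ []
  filter-single {xs = x ∷ xs} (x∉ ∷ _) (here refl) px only =
    trans (filter-accept P? px)
      (cong (x ∷_) (filter-none P? (All.tabulate λ z∈ pz → All.lookup x∉ z∈ (sym (only (there z∈) pz)))))
  filter-single {xs = y ∷ xs} (y∉ ∷ xs!) (there x∈) px only =
    trans (filter-reject P? λ py → All.lookup y∉ x∈ (only (here refl) py))
      (filter-single xs! x∈ px (only ∘ there))

  filter-double : ∀ {x y xs} → Unique xs → x ≢ y → x ∈ xs → y ∈ xs → P x → P y →
                  (∀ {z} → P z → z ≡ x ⊎ z ≡ y) →
                  (filter P? xs ≡ x ∷ y ∷ []) ⊎ (filter P? xs ≡ y ∷ x ∷ [])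
  filter-double _ x≢y (here refl) (here refl) _ _ _ = contradiction refl x≢y
  filter-double (x∉ ∷ xs!) _ (here refl) (there y∈) px py only =
    inj₁ (trans (filter-accept P? px) (cong (_ ∷_) (filter-single xs! y∈ py λ z∈ pz →
      [ (λ z≡x → contradiction (sym z≡x) (All.lookup x∉ z∈)) , id ]′ (only pz))))
  filter-double (y∉ ∷ xs!) _ (there x∈) (here refl) px py only =
    inj₂ (trans (filter-accept P? py) (cong (_ ∷_) (filter-single xs! x∈ px λ z∈ pz →
      [ id , (λ z≡y → contradiction (sym z≡y) (All.lookup y∉ z∈)) ]′ (only pz))))
  filter-double (z∉ ∷ xs!) x≢y (there x∈) (there y∈) px py only =
    Sum.map (trans skip) (trans skip) (filter-double xs! x≢y x∈ y∈ px py only)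
    where
    skip = filter-reject P? λ pz → [ All.lookup z∉ x∈ , All.lookup z∉ y∈ ]′ (only pz)

module _ {A : Set} {R : A → A → Set} where

  Linked-++ˡ : ∀ xs {ys} → Linked R (xs ++ ys) → Linked R xs
  Linked-++ˡ []           _        = []
  Linked-++ˡ (x ∷ [])     _        = [-]
  Linked-++ˡ (x ∷ y ∷ xs) (r ∷ rs) = r ∷ Linked-++ˡ (y ∷ xs) rs

  Linked-++ʳ : ∀ xs {ys} → Linked R (xs ++ ys) → Linked R ys
  Linked-++ʳ []       l = l
  Linked-++ʳ (x ∷ xs) l = Linked-++ʳ xs (Linked.tail l)

-- Stable sorting with five keys.

module _ {T : Set} where

  -- With gaps as keys, this is the order in which a zone reads its B-letters; see `zone-[]`.
  sortBy : (T → Fin 5) → List T → List T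
  sortBy c L = at 0F ++ at 1F ++ at 2F ++ at 3F ++ at 4F
    where
    at : Fin 5 → List T
    at g = filter (λ t → c t ≟ g) L

  -- Each key class is itself a filter, and filters commute. The relative order of two letters can
  -- thus be computed from these two letters alone.
  filter-sortBy : {P : T → Set} (P? : Decidable P) → ∀ c L →
                  filter P? (sortBy c L) ≡ sortBy c (filter P? L)
  filter-sortBy P? c L =
    step 0F (step 1F (step 2F (step 3F (filter-comm P? _ L))))
    where
    step : ∀ g {xs ys} → filter P? xs ≡ ys →
           filter P? (filter (λ t → c t ≟ g) L ++ xs) ≡ filter (λ t → c t ≟ g) (filter P? L) ++ ys
    step g {xs} eq = trans (filter-++ P? (filter _ L) xs) (cong₂ _++_ (filter-comm P? _ L) eq)

  sortBy-[x] : ∀ c x → sortBy c (x ∷ []) ≡ x ∷ []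
  sortBy-[x] c x with c x
  ... | 0F = refl
  ... | 1F = refl
  ... | 2F = refl
  ... | 3F = refl
  ... | 4F = refl

sortBy-map : ∀ {S T : Set} (f : S → T) {c : T → Fin 5} {c′ : S → Fin 5} →
             (∀ s → c (f s) ≡ c′ s) → ∀ L → sortBy c (map f L) ≡ map f (sortBy c′ L)
sortBy-map f {c} {c′} eq L = step 0F (step 1F (step 2F (step 3F (at 4F))))
  where
  at : ∀ g → filter (λ t → c t ≟ g) (map f L) ≡ map f (filter (λ s → c′ s ≟ g) L)
  at g = trans (filter-map _ f L) (cong (map f)
    (filter-≐ _ _ ((λ {s} → trans (sym (eq s))) , (λ {s} → trans (eq s))) L))
  step : ∀ g {xs ys} → xs ≡ map f ys →
         filter (λ t → c t ≟ g) (map f L) ++ xs ≡ map f (filter (λ s → c′ s ≟ g) L ++ ys)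
  step g {ys = ys} e = trans (cong₂ _++_ (at g) e) (sym (map-++ f _ ys))

-- The orders of the B-letters in the first three zones.

-- (class of b at the third pair, defect of b at the first chain, at the second).
Key : Set
Key = Fin 4 × Fin 3 × Fin 3

-- At a chain pair a letter b with defect d may leave the central gap on
-- either side; the Boolean chooses the side.
leave : Bool → Fin 3 → Fin 5
leave _     0F = 2F
leave true  1F = 3F
leave true  2F = 4F
leave false 1F = 1F
leave false 2F = 0F

-- For classes t < t′ some coordinate has sign true at t and false at t′,
-- so in that zone t lies weakly right and t′ weakly left of the centre,
-- whereas in the third zone t comes first.
sign₁ sign₂ : Fin 4 → Bool
sign₁ 0F = true
sign₁ 1F = true
sign₁ 2F = false
sign₁ 3F = false
sign₂ 0F = true
sign₂ 1F = false
sign₂ 2F = true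
sign₂ 3F = false

gap₁ gap₂ gap₃ : Key → Fin 5
gap₁ (t , d , _) = leave (sign₁ t) d
gap₂ (t , _ , d) = leave (sign₂ t) d
gap₃ (t , _ , _) = suc t

module Orders {T : Set} (key : T → Key) where

  -- Ties in zones 1 and 2 put the larger class first; inside one class,
  -- zone 3 reverses zone 1.
  base order₁ order₂ order₃ : List T → List T
  base   L = sortBy (opposite ∘ gap₃ ∘ key) L
  order₁ L = sortBy (gap₁ ∘ key) (base L)
  order₂ L = sortBy (gap₂ ∘ key) (base L)
  order₃ L = sortBy (gap₃ ∘ key) (reverse (order₁ L))

  module _ {P : T → Set} (P? : Decidable P) (L : List T) where

    filter-base : filter P? (base L) ≡ base (filter P? L)
    filter-base = filter-sortBy P? _ L

    filter-order₁ : filter P? (order₁ L) ≡ order₁ (filter P? L)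
    filter-order₁ = trans (filter-sortBy P? _ (base L)) (cong (sortBy _) filter-base)

    filter-order₂ : filter P? (order₂ L) ≡ order₂ (filter P? L)
    filter-order₂ = trans (filter-sortBy P? _ (base L)) (cong (sortBy _) filter-base)

    filter-order₃ : filter P? (order₃ L) ≡ order₃ (filter P? L)
    filter-order₃ = trans (filter-sortBy P? _ (reverse (order₁ L)))
      (cong (sortBy _) (trans (filter-reverse P? (order₁ L)) (cong reverse filter-order₁)))

module _ {S T : Set} (f : S → T) (key : T → Key) (key′ : S → Key)
         (eq : ∀ s → key (f s) ≡ key′ s) (L : List S) where

  private
    module S = Orders key′
    module T = Orders key

  map-base : T.base (map f L) ≡ map f (S.base L)
  map-base = sortBy-map f (cong (opposite ∘ gap₃) ∘ eq) L

  map-order₁ : T.order₁ (map f L) ≡ map f (S.order₁ L)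
  map-order₁ = trans (cong (sortBy _) map-base) (sortBy-map f (cong gap₁ ∘ eq) (S.base L))

  map-order₂ : T.order₂ (map f L) ≡ map f (S.order₂ L)
  map-order₂ = trans (cong (sortBy _) map-base) (sortBy-map f (cong gap₂ ∘ eq) (S.base L))

  map-order₃ : T.order₃ (map f L) ≡ map f (S.order₃ L)
  map-order₃ = trans (cong (sortBy _) (trans (cong reverse map-order₁) (sym (reverse-map f (S.order₁ L)))))
    (sortBy-map f (cong gap₃ ∘ eq) (reverse (S.order₁ L)))

pick : {T : Set} → T → T → Bool → T
pick x y z = if z then y else x

pair : List Bool
pair = false ∷ true ∷ []

-- What Z₁ Z₂ Z₃ shows of two B-letters with these keys. The Booleans name the letters, `false`
-- being the one listed first, so the pattern depends on the keys alone.
trace : Key → Key → List Bool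
trace κ₀ κ₁ = order₁ pair ++ order₂ pair ++ order₃ pair
  where open Orders (pick κ₀ κ₁)

-- The trace consists of three arrangements of two letters and alternates only if all three agree.
-- For distinct classes the signs make zone 1 or zone 2 oppose zone 3; within one class zone 3
-- reverses zone 1.
trace-clash : ∀ κ₀ κ₁ → ¬ Linked _≢_ (trace κ₀ κ₁)
trace-clash (t , d , e) (t′ , d′ , e′) = checked t d e t′ d′ e′
  where
  checked : ∀ t d e t′ d′ e′ → ¬ Linked _≢_ (trace (t , d , e) (t′ , d′ , e′))
  -- There are 36 keys, so the claim is settled by deciding all 36 × 36 cases.
  checked = from-yes (all? λ t → all? λ d → all? λ e → all? λ t′ → all? λ d′ → all? λ e′ →
    ¬? (linked? (λ x y → ¬? (x Bool.≟ y)) (trace (t , d , e) (t′ , d′ , e′))))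

-- Phrased as a restriction, so that it passes through sorting and reversal by the commutation
-- lemmas.
Once : ∀ {n} → List (Fin n) → Set
Once L = ∀ x → filter (_≟ x) L ≡ x ∷ []

allFin-once : ∀ n → Once (allFin n)
allFin-once n x = filter-single (_≟ x) (allFin⁺ n) (∈-allFin x) refl (λ _ → id)

sortBy-once : ∀ {n} (c : Fin n → Fin 5) L → Once L → Once (sortBy c L)
sortBy-once c L once x =
  trans (filter-sortBy (_≟ x) c L) (trans (cong (sortBy c) (once x)) (sortBy-[x] c x))

reverse-once : ∀ {n} (L : List (Fin n)) → Once L → Once (reverse L)
reverse-once L once x = trans (filter-reverse (_≟ x) L) (cong reverse (once x))

-- Pairs, zones and the word.

_∈ₑ_ : ∀ {m} → Fin m → Fin m × Fin m → Set
a ∈ₑ (x , y) = a ≡ x ⊎ a ≡ y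

_∈ₑ?_ : ∀ {m} (a : Fin m) e → Dec (a ∈ₑ e)
a ∈ₑ? (x , y) = (a ≟ x) ⊎-dec (a ≟ y)

Apart : ∀ {m} → Fin m × Fin m → Fin m × Fin m → Set
Apart e e′ = ∀ {a} → a ∈ₑ e → a ∈ₑ e′ → ⊥

-- Whether gap g lies between the two occurrences of x₁ (of x₂) in the
-- zone x₁ x₂ x₂ x₁ (true) or x₁ x₂ x₁ x₂ (false).
inside₁ inside₂ : Bool → Fin 5 → Bool
inside₁ _     0F = false
inside₁ _     1F = true
inside₁ _     2F = true
inside₁ n     3F = n
inside₁ _     4F = false
inside₂ _     0F = false
inside₂ _     1F = false
inside₂ _     2F = true
inside₂ true  3F = false
inside₂ false 3F = true
inside₂ _     4F = false

module _ {m p : ℕ} where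

  -- The separators are words rather than letters: a restricted zone is then again a zone, with some
  -- separators empty.
  zone : (X₁ X₂ X₃ X₄ : Word m p) → (Fin p → Fin 5) → List (Fin p) → Word m p
  zone X₁ X₂ X₃ X₄ c L = at 0F ++ X₁ ++ at 1F ++ X₂ ++ at 2F ++ X₃ ++ at 3F ++ X₄ ++ at 4F
    where
    at : Fin 5 → Word m p
    at g = map inj₂ (filter (λ b → c b ≟ g) L)

  zone-[] : ∀ c L → zone [] [] [] [] c L ≡ map inj₂ (sortBy c L)
  zone-[] c L = step 0F (step 1F (step 2F (step 3F refl)))
    where
    step : ∀ g {w : Word m p} {ys} → w ≡ map inj₂ ys →
           map inj₂ (filter (λ b → c b ≟ g) L) ++ w ≡ map inj₂ (filter (λ b → c b ≟ g) L ++ ys)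
    step g {ys = ys} eq = trans (cong (_ ++_) eq) (sym (map-++ inj₂ _ ys))

  filter-zone : {P : V m p → Set} (P? : Decidable P) → ∀ {X₁ X₂ X₃ X₄ Y₁ Y₂ Y₃ Y₄} c L {L′} →
    filter P? X₁ ≡ Y₁ → filter P? X₂ ≡ Y₂ → filter P? X₃ ≡ Y₃ → filter P? X₄ ≡ Y₄ →
    filter (P? ∘ inj₂) L ≡ L′ →
    filter P? (zone X₁ X₂ X₃ X₄ c L) ≡ zone Y₁ Y₂ Y₃ Y₄ c L′
  filter-zone P? {X₁} {X₂} {X₃} {X₄} c L refl refl refl refl refl =
    step 0F X₁ (step 1F X₂ (step 2F X₃ (step 3F X₄ (at 4F))))
    where
    at : ∀ g → filter P? (map inj₂ (filter (λ b → c b ≟ g) L))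
             ≡ map inj₂ (filter (λ b → c b ≟ g) (filter (P? ∘ inj₂) L))
    at g = trans (filter-map P? inj₂ (filter _ L)) (cong (map inj₂) (filter-comm (P? ∘ inj₂) _ L))
    step : ∀ g X {w w′} → filter P? w ≡ w′ →
           filter P? (map inj₂ (filter (λ b → c b ≟ g) L) ++ X ++ w)
           ≡ map inj₂ (filter (λ b → c b ≟ g) (filter (P? ∘ inj₂) L)) ++ filter P? X ++ w′
    step g X {w} eq = trans (filter-++ P? (map inj₂ (filter _ L)) (X ++ w))
      (cong₂ _++_ (at g) (trans (filter-++ P? X w) (cong (_ ++_) eq)))

  -- A pair of A-letters, the gap in which its zone x₁ x₂ x₃ x₄ holds each
  -- b, the order of the A-letters that follow the zone, and the order of
  -- the B-letters sharing a gap.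
  record Block : Set where
    constructor block
    field
      nested : Bool
      ends   : Fin m × Fin m
      gap    : Fin p → Fin 5
      orderA : List (Fin m)
      orderB : List (Fin p)

    x₁ x₂ x₃ x₄ : Fin m
    x₁ = proj₁ ends
    x₂ = proj₂ ends
    x₃ = if nested then x₂ else x₁
    x₄ = if nested then x₁ else x₂

  open Block

  [_]ᴬ : Fin m → Word m p
  [ a ]ᴬ = inj₁ a ∷ []

  zoneOf : Block → Word m p
  zoneOf β = zone [ x₁ β ]ᴬ [ x₂ β ]ᴬ [ x₃ β ]ᴬ [ x₄ β ]ᴬ (gap β) (orderB β)

  outside? : (β β′ : Block) → Decidable (λ a → ¬ a ∈ₑ ends β × ¬ a ∈ₑ ends β′)
  outside? β β′ a = ¬? (a ∈ₑ? ends β) ×-dec ¬? (a ∈ₑ? ends β′)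

  mid : Block → Block → Word m p
  mid β β′ = map inj₁ (filter (outside? β β′) (orderA β))

  turn : Block → Block → Word m p
  turn β β′ = zoneOf β ++ mid β β′

  -- ω is the block that cyclically follows the last one.
  word : Block → List Block → Block → Word m p
  word β []        ω = turn β ω
  word β (β′ ∷ βs) ω = turn β β′ ++ word β′ βs ω

  -- The zone after one letter of its pair is erased; the Boolean is `nested`, which fixes where the
  -- second copy of the surviving letter stands.
  solo₁ solo₂ : Bool → Fin m → (Fin p → Fin 5) → List (Fin p) → Word m p
  solo₁ true  a = zone [ a ]ᴬ [] [] [ a ]ᴬ
  solo₁ false a = zone [ a ]ᴬ [] [ a ]ᴬ []
  solo₂ true  a = zone [] [ a ]ᴬ [ a ]ᴬ []
  solo₂ false a = zone [] [ a ]ᴬ [] [ a ]ᴬ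

  module _ {P : V m p → Set} (P? : Decidable P) where

    keep : ∀ {a} → P (inj₁ a) → filter P? [ a ]ᴬ ≡ [ a ]ᴬ
    keep = filter-accept P?

    drop : ∀ {a} → ¬ P (inj₁ a) → filter P? [ a ]ᴬ ≡ []
    drop = filter-reject P?

    filter-zoneOf-none : ∀ β {L} → ¬ P (inj₁ (x₁ β)) → ¬ P (inj₁ (x₂ β)) →
      filter (P? ∘ inj₂) (orderB β) ≡ L →
      filter P? (zoneOf β) ≡ zone [] [] [] [] (gap β) L
    filter-zoneOf-none (block true  _ c _ L) n₁ n₂ =
      filter-zone P? c L (drop n₁) (drop n₂) (drop n₂) (drop n₁)
    filter-zoneOf-none (block false _ c _ L) n₁ n₂ =
      filter-zone P? c L (drop n₁) (drop n₂) (drop n₁) (drop n₂)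

    filter-zoneOf-x₁ : ∀ β {L} → P (inj₁ (x₁ β)) → ¬ P (inj₁ (x₂ β)) →
      filter (P? ∘ inj₂) (orderB β) ≡ L →
      filter P? (zoneOf β) ≡ solo₁ (nested β) (x₁ β) (gap β) L
    filter-zoneOf-x₁ (block true  _ c _ L) p₁ n₂ =
      filter-zone P? c L (keep p₁) (drop n₂) (drop n₂) (keep p₁)
    filter-zoneOf-x₁ (block false _ c _ L) p₁ n₂ =
      filter-zone P? c L (keep p₁) (drop n₂) (keep p₁) (drop n₂)

    filter-zoneOf-x₂ : ∀ β {L} → ¬ P (inj₁ (x₁ β)) → P (inj₁ (x₂ β)) →
      filter (P? ∘ inj₂) (orderB β) ≡ L →
      filter P? (zoneOf β) ≡ solo₂ (nested β) (x₂ β) (gap β) L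
    filter-zoneOf-x₂ (block true  _ c _ L) n₁ p₂ =
      filter-zone P? c L (drop n₁) (keep p₂) (keep p₂) (drop n₁)
    filter-zoneOf-x₂ (block false _ c _ L) n₁ p₂ =
      filter-zone P? c L (drop n₁) (keep p₂) (drop n₁) (keep p₂)

    filter-zoneOf-both : ∀ β → P (inj₁ (x₁ β)) → P (inj₁ (x₂ β)) →
      filter (P? ∘ inj₂) (orderB β) ≡ [] →
      filter P? (zoneOf β) ≡ inj₁ (x₁ β) ∷ inj₁ (x₂ β) ∷ inj₁ (x₃ β) ∷ inj₁ (x₄ β) ∷ []
    filter-zoneOf-both (block true  _ c _ L) p₁ p₂ =
      filter-zone P? c L (keep p₁) (keep p₂) (keep p₂) (keep p₁)
    filter-zoneOf-both (block false _ c _ L) p₁ p₂ =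
      filter-zone P? c L (keep p₁) (keep p₂) (keep p₁) (keep p₂)

    filter-mid : ∀ β β′ → filter P? (mid β β′)
      ≡ map inj₁ (filter (outside? β β′) (filter (P? ∘ inj₁) (orderA β)))
    filter-mid β β′ = trans (filter-map P? inj₁ (filter _ (orderA β)))
      (cong (map inj₁) (filter-comm (P? ∘ inj₁) _ (orderA β)))

    Linked-turn : ∀ β β′ {w} → Linked _≢_ (filter P? (turn β β′ ++ w)) →
      Linked _≢_ (filter P? (zoneOf β))
    Linked-turn β β′ {w} l = Linked-++ˡ _ (subst (Linked _≢_) (filter-++ P? (zoneOf β) _)
      (Linked-++ˡ _ (subst (Linked _≢_) (filter-++ P? (turn β β′) w) l)))

    -- A zone is a contiguous factor of the word, also after restriction, so a repetition inside one
    -- zone refutes alternation in the whole word.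
    Linked-zoneOf : ∀ {β γ} βs {ω} → γ ∈ β ∷ βs →
      Linked _≢_ (filter P? (word β βs ω)) → Linked _≢_ (filter P? (zoneOf γ))
    Linked-zoneOf {β} [] {ω} (here refl) l =
      Linked-++ˡ _ (subst (Linked _≢_) (filter-++ P? (zoneOf β) (mid β ω)) l)
    Linked-zoneOf {β} (β′ ∷ βs) (here refl) l = Linked-turn β β′ {word β′ βs _} l
    Linked-zoneOf {β} (β′ ∷ βs) (there γ∈) l = Linked-zoneOf βs γ∈
      (Linked-++ʳ (filter P? (turn β β′)) (subst (Linked _≢_) (filter-++ P? (turn β β′) _) l))

  data Path : Block → List Block → Block → Set where
    last : ∀ {β ω} → Apart (ends β) (ends ω) → Path β [] ω
    _∷_  : ∀ {β β′ βs ω} → Apart (ends β) (ends β′) → Path β′ βs ω → Path β (β′ ∷ βs) ω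

  record Valid (E : Fin m → Fin p → Bool) (β : Block) : Set where
    field
      x₁≢x₂  : x₁ β ≢ x₂ β
      edge₁  : ∀ b → E (x₁ β) b ≡ inside₁ (nested β) (gap β b)
      edge₂  : ∀ b → E (x₂ β) b ≡ inside₂ (nested β) (gap β b)
      onceA  : Once (orderA β)
      onceB  : Once (orderB β)

-- Alternation of an A-letter with a B-letter.

filter-empty : ∀ {T : Set} {P : T → Set} (P? : Decidable P) → (∀ {t} → ¬ P t) →
               ∀ L → filter P? L ≡ []
filter-empty P? ¬P L = filter-none P? (All.universal (λ _ → ¬P) L)

filter-once : ∀ {n} {P : Fin n → Set} (P? : Decidable P) L {x} → Once L → P x →
              (∀ {z} → P z → z ≡ x) → filter P? L ≡ x ∷ []
filter-once P? L {x} once Px only = trans (filter-≐ P? (_≟ x) (only , λ { refl → Px }) L) (once x)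

module _ {m p : ℕ} where

  open Block

  solo-inside₁ : ∀ n a (c : Fin p → Fin 5) b → inside₁ n (c b) ≡ true →
                 solo₁ {m} n a c (b ∷ []) ≡ inj₁ a ∷ inj₂ b ∷ inj₁ a ∷ []
  solo-inside₁ true  a c b i with c b
  ... | 1F = refl
  ... | 2F = refl
  ... | 3F = refl
  solo-inside₁ true  a c b () | 4F
  solo-inside₁ false a c b i with c b
  ... | 1F = refl
  ... | 2F = refl
  solo-inside₁ false a c b () | 3F
  solo-inside₁ false a c b () | 4F

  solo-inside₂ : ∀ n a (c : Fin p → Fin 5) b → inside₂ n (c b) ≡ true →
                 solo₂ {m} n a c (b ∷ []) ≡ inj₁ a ∷ inj₂ b ∷ inj₁ a ∷ []
  solo-inside₂ true  a c b i with c b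
  ... | 2F = refl
  solo-inside₂ true  a c b () | 3F
  solo-inside₂ true  a c b () | 4F
  solo-inside₂ false a c b i with c b
  ... | 2F = refl
  ... | 3F = refl
  solo-inside₂ false a c b () | 4F

  -- A gap that is not inside puts `b` before both copies of `a` or after both, so the two copies
  -- become neighbours.
  solo-outside₁ : ∀ n a (c : Fin p → Fin 5) b → inside₁ n (c b) ≡ false →
                  ¬ Linked _≢_ (solo₁ {m} n a c (b ∷ []))
  solo-outside₁ true  a c b i l with c b
  solo-outside₁ true  a c b i (_ ∷ a≢a ∷ _) | 0F = a≢a refl
  solo-outside₁ true  a c b i (a≢a ∷ _)     | 4F = a≢a refl
  solo-outside₁ false a c b i l with c b
  solo-outside₁ false a c b i (_ ∷ a≢a ∷ _) | 0F = a≢a refl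
  solo-outside₁ false a c b i (a≢a ∷ _)     | 3F = a≢a refl
  solo-outside₁ false a c b i (a≢a ∷ _)     | 4F = a≢a refl

  solo-outside₂ : ∀ n a (c : Fin p → Fin 5) b → inside₂ n (c b) ≡ false →
                  ¬ Linked _≢_ (solo₂ {m} n a c (b ∷ []))
  solo-outside₂ true  a c b i l with c b
  solo-outside₂ true  a c b i (_ ∷ a≢a ∷ _) | 0F = a≢a refl
  solo-outside₂ true  a c b i (_ ∷ a≢a ∷ _) | 1F = a≢a refl
  solo-outside₂ true  a c b i (a≢a ∷ _)     | 3F = a≢a refl
  solo-outside₂ true  a c b i (a≢a ∷ _)     | 4F = a≢a refl
  solo-outside₂ false a c b i l with c b
  solo-outside₂ false a c b i (_ ∷ a≢a ∷ _) | 0F = a≢a refl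
  solo-outside₂ false a c b i (_ ∷ a≢a ∷ _) | 1F = a≢a refl
  solo-outside₂ false a c b i (a≢a ∷ _)     | 4F = a≢a refl

  solo₁-[] : ∀ n a (c : Fin p → Fin 5) → solo₁ {m} n a c [] ≡ inj₁ a ∷ inj₁ a ∷ []
  solo₁-[] true  a c = refl
  solo₁-[] false a c = refl

  solo₂-[] : ∀ n a (c : Fin p → Fin 5) → solo₂ {m} n a c [] ≡ inj₁ a ∷ inj₁ a ∷ []
  solo₂-[] true  a c = refl
  solo₂-[] false a c = refl

  zone-[]-[b] : ∀ c b → zone {m} {p} [] [] [] [] c (b ∷ []) ≡ inj₂ b ∷ []
  zone-[]-[b] c b = trans (zone-[] c (b ∷ [])) (cong (map inj₂) (sortBy-[x] c b))

  module _ {P : V m p → Set} (P? : Decidable P) {a} (Pa : P (inj₁ a))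
           (only : ∀ {z} → P (inj₁ z) → z ≡ a) where

    mid-without : ∀ (β β′ : Block {m} {p}) → Once (orderA β) → a ∈ₑ ends β ⊎ a ∈ₑ ends β′ →
                  filter P? (mid β β′) ≡ []
    mid-without β β′ once a∈ = trans (filter-mid P? β β′) (cong (map inj₁)
      (trans (cong (filter (outside? β β′)) (filter-once (P? ∘ inj₁) (orderA β) once Pa only))
        (filter-reject (outside? β β′) λ { (∉β , ∉β′) → [ ∉β , ∉β′ ]′ a∈ })))

    mid-with : ∀ (β β′ : Block {m} {p}) → Once (orderA β) → ¬ a ∈ₑ ends β → ¬ a ∈ₑ ends β′ →
               filter P? (mid β β′) ≡ [ a ]ᴬ
    mid-with β β′ once ∉β ∉β′ = trans (filter-mid P? β β′) (cong (map inj₁)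
      (trans (cong (filter (outside? β β′)) (filter-once (P? ∘ inj₁) (orderA β) once Pa only))
        (filter-accept (outside? β β′) (∉β , ∉β′))))

  module Edges (E : Fin m → Fin p → Bool) (a : Fin m) (b : Fin p) where

    ab? : Decidable (λ (z : V m p) → z ≡ inj₁ a ⊎ z ≡ inj₂ b)
    ab? z = (z ≟V inj₁ a) ⊎-dec (z ≟V inj₂ b)

    onlyA : ∀ {z} → inj₁ z ≡ inj₁ {B = Fin p} a ⊎ inj₁ z ≡ inj₂ b → z ≡ a
    onlyA (inj₁ refl) = refl

    onlyB : ∀ {z} → inj₂ z ≡ inj₁ a ⊎ inj₂ z ≡ inj₂ {A = Fin m} b → z ≡ b
    onlyB (inj₂ refl) = refl

    module _ {β : Block} (v : Valid E β) where

      open Valid v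

      private
        b-once : filter (ab? ∘ inj₂) (orderB β) ≡ b ∷ []
        b-once = filter-once (ab? ∘ inj₂) (orderB β) onceB (inj₂ refl) onlyB

      zone-near : a ∈ₑ ends β → E a b ≡ true →
                  filter ab? (zoneOf β) ≡ inj₁ a ∷ inj₂ b ∷ inj₁ a ∷ []
      zone-near (inj₁ refl) e = trans
        (filter-zoneOf-x₁ ab? β (inj₁ refl) (x₁≢x₂ ∘ sym ∘ onlyA) b-once)
        (solo-inside₁ (nested β) a (gap β) b (trans (sym (edge₁ b)) e))
      zone-near (inj₂ refl) e = trans
        (filter-zoneOf-x₂ ab? β (x₁≢x₂ ∘ onlyA) (inj₁ refl) b-once)
        (solo-inside₂ (nested β) a (gap β) b (trans (sym (edge₂ b)) e))

      zone-far : a ∈ₑ ends β → E a b ≡ false → ¬ Linked _≢_ (filter ab? (zoneOf β))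
      zone-far (inj₁ refl) e = solo-outside₁ (nested β) a (gap β) b (trans (sym (edge₁ b)) e)
        ∘ subst (Linked _≢_) (filter-zoneOf-x₁ ab? β (inj₁ refl) (x₁≢x₂ ∘ sym ∘ onlyA) b-once)
      zone-far (inj₂ refl) e = solo-outside₂ (nested β) a (gap β) b (trans (sym (edge₂ b)) e)
        ∘ subst (Linked _≢_) (filter-zoneOf-x₂ ab? β (x₁≢x₂ ∘ onlyA) (inj₁ refl) b-once)

      zone-away : ¬ a ∈ₑ ends β → filter ab? (zoneOf β) ≡ inj₂ b ∷ []
      zone-away a∉ = trans
        (filter-zoneOf-none ab? β (a∉ ∘ inj₁ ∘ sym ∘ onlyA) (a∉ ∘ inj₂ ∘ sym ∘ onlyA) b-once)
        (zone-[]-[b] (gap β) b)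

    -- The last letter before the zone of β in the restriction to {a, b}; for
    -- the first block it is the last letter of the whole word, read cyclically.
    before : Block {m} {p} → V m p
    before β = if does (a ∈ₑ? ends β) then inj₂ b else inj₁ a

    before-own : ∀ β → a ∈ₑ ends β → before β ≡ inj₂ b
    before-own β a∈ rewrite dec-true (a ∈ₑ? ends β) a∈ = refl

    before-other : ∀ β → ¬ a ∈ₑ ends β → before β ≡ inj₁ a
    before-other β a∉ rewrite dec-false (a ∈ₑ? ends β) a∉ = refl

    -- For an edge the restricted turn is `a b a` if `a` belongs to `β`, `b` if it belongs to `β′`,
    -- and `b a` otherwise. Each of these starts with the letter other than `before β` and ends with
    -- `before β′`, so turns can be chained.
    turn-alternates : ∀ {β β′ w} → Valid E β → E a b ≡ true → Apart (ends β) (ends β′) →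
      Linked _≢_ (before β′ ∷ filter ab? w) → Linked _≢_ (before β ∷ filter ab? (turn β β′ ++ w))
    turn-alternates {β} {β′} {w} v e apart l
      rewrite filter-++ ab? (turn β β′) w | filter-++ ab? (zoneOf β) (mid β β′)
      with a ∈ₑ? ends β | a ∈ₑ? ends β′
    ... | yes ∈β | yes ∈β′ = ⊥-elim (apart ∈β ∈β′)
    ... | yes ∈β | no ∉β′
      rewrite before-own β ∈β | before-other β′ ∉β′ | zone-near v ∈β e
            | mid-without ab? (inj₁ refl) onlyA β β′ (Valid.onceA v) (inj₁ ∈β)
      = (λ ()) ∷ (λ ()) ∷ (λ ()) ∷ l
    ... | no ∉β | yes ∈β′
      rewrite before-other β ∉β | before-own β′ ∈β′ | zone-away v ∉β
            | mid-without ab? (inj₁ refl) onlyA β β′ (Valid.onceA v) (inj₂ ∈β′)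
      = (λ ()) ∷ l
    ... | no ∉β | no ∉β′
      rewrite before-other β ∉β | before-other β′ ∉β′ | zone-away v ∉β
            | mid-with ab? (inj₁ refl) onlyA β β′ (Valid.onceA v) ∉β ∉β′
      = (λ ()) ∷ (λ ()) ∷ l

    word-alternates : ∀ {β βs ω} → All (Valid E) (β ∷ βs) → E a b ≡ true → Path β βs ω →
                      Linked _≢_ (before β ∷ filter ab? (word β βs ω))
    word-alternates {β} {[]} {ω} (v ∷ []) e (last apart) =
      subst (λ w → Linked _≢_ (before β ∷ filter ab? w)) (++-identityʳ (turn β ω))
        (turn-alternates {β} {ω} {[]} v e apart [-])
    word-alternates {β} {β′ ∷ βs} {ω} (v ∷ vs) e (apart ∷ path) =
      turn-alternates {β} {β′} {word β′ βs ω} v e apart (word-alternates vs e path)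

  -- Uniformity of the word.

  occ-++ : ∀ v (w w′ : Word m p) → occ v (w ++ w′) ≡ occ v w + occ v w′
  occ-++ v w w′ = trans (cong length (filter-++ (_≟V v) w w′)) (length-++ (filter (_≟V v) w))

  module _ {E : Fin m → Fin p → Bool} where

    occB-turn : ∀ b {β} β′ → Valid E β → occ (inj₂ b) (turn β β′) ≡ 1
    occB-turn b {β} β′ v = trans (occ-++ (inj₂ b) (zoneOf β) (mid β β′))
      (cong₂ (λ z w → length z + length w)
        (trans (filter-zoneOf-none b? β (λ ()) (λ ())
                 (filter-once (b? ∘ inj₂) (orderB β) (Valid.onceB v) refl λ { refl → refl }))
               (zone-[]-[b] (gap β) b))
        (trans (filter-mid b? β β′) (cong (map inj₁ ∘ filter (outside? β β′))
          (filter-empty (b? ∘ inj₁) (λ ()) (orderA β)))))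
      where
      b? = _≟V inj₂ {A = Fin m} b

    occB : ∀ b {β βs ω} → All (Valid E) (β ∷ βs) → occ (inj₂ b) (word β βs ω) ≡ length (β ∷ βs)
    occB b {βs = []} {ω} (v ∷ []) = occB-turn b ω v
    occB b {β} {β′ ∷ βs} (v ∷ vs) = trans (occ-++ _ (turn β β′) (word β′ βs _))
      (cong₂ _+_ (occB-turn b β′ v) (occB b vs))

    module _ (a : Fin m) where

      private
        a? = _≟V inj₁ {B = Fin p} a
        onlyA : ∀ {z} → inj₁ {B = Fin p} z ≡ inj₁ a → z ≡ a
        onlyA refl = refl

      owns : Block {m} {p} → ℕ
      owns β = if does (a ∈ₑ? ends β) then 1 else 0

      owns-own : ∀ β → a ∈ₑ ends β → owns β ≡ 1
      owns-own β a∈ rewrite dec-true (a ∈ₑ? ends β) a∈ = refl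

      owns-other : ∀ β → ¬ a ∈ₑ ends β → owns β ≡ 0
      owns-other β a∉ rewrite dec-false (a ∈ₑ? ends β) a∉ = refl

      occA-zone : ∀ {β} → Valid E β → a ∈ₑ ends β → occ (inj₁ a) (zoneOf β) ≡ 2
      occA-zone {β} v (inj₁ refl) = cong length (trans
        (filter-zoneOf-x₁ a? β refl (Valid.x₁≢x₂ v ∘ sym ∘ onlyA) (filter-empty (a? ∘ inj₂) (λ ()) (orderB β)))
        (solo₁-[] (nested β) a (gap β)))
      occA-zone {β} v (inj₂ refl) = cong length (trans
        (filter-zoneOf-x₂ a? β (Valid.x₁≢x₂ v ∘ onlyA) refl (filter-empty (a? ∘ inj₂) (λ ()) (orderB β)))
        (solo₂-[] (nested β) a (gap β)))

      occA-zone-away : ∀ β → ¬ a ∈ₑ ends β → occ (inj₁ a) (zoneOf β) ≡ 0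
      occA-zone-away β a∉ = cong length
        (filter-zoneOf-none a? β (a∉ ∘ inj₁ ∘ sym ∘ onlyA) (a∉ ∘ inj₂ ∘ sym ∘ onlyA)
          (filter-empty (a? ∘ inj₂) (λ ()) (orderB β)))

      -- A turn holds `a` twice, never or once, according as `a` belongs to `β`, to `β′` or to
      -- neither. The `owns` terms express the deviation from one as a difference, which telescopes
      -- along the word.
      occA-turn : ∀ {β β′} → Valid E β → Apart (ends β) (ends β′) →
                  occ (inj₁ a) (turn β β′) + owns β′ ≡ 1 + owns β
      occA-turn {β} {β′} v apart
        rewrite occ-++ (inj₁ a) (zoneOf β) (mid β β′)
        with a ∈ₑ? ends β | a ∈ₑ? ends β′
      ... | yes ∈β | yes ∈β′ = ⊥-elim (apart ∈β ∈β′)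
      ... | yes ∈β | no ∉β′
        rewrite owns-own β ∈β | owns-other β′ ∉β′ | occA-zone v ∈β | mid-without a? refl onlyA β β′ (Valid.onceA v) (inj₁ ∈β) = refl
      ... | no ∉β | yes ∈β′
        rewrite owns-other β ∉β | owns-own β′ ∈β′ | occA-zone-away β ∉β | mid-without a? refl onlyA β β′ (Valid.onceA v) (inj₂ ∈β′) = refl
      ... | no ∉β | no ∉β′
        rewrite owns-other β ∉β | owns-other β′ ∉β′ | occA-zone-away β ∉β | mid-with a? refl onlyA β β′ (Valid.onceA v) ∉β ∉β′ = refl

      occA : ∀ {β βs ω} → All (Valid E) (β ∷ βs) → Path β βs ω →
             occ (inj₁ a) (word β βs ω) + owns ω ≡ length (β ∷ βs) + owns β
      occA {β} {[]} {ω} (v ∷ []) (last apart) = occA-turn {β} {ω} v apart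
      occA {β} {β′ ∷ βs} {ω} (v ∷ vs) (apart ∷ path) = begin
        occ (inj₁ a) (turn β β′ ++ word β′ βs ω) + owns ω  ≡⟨ cong (_+ owns ω) (occ-++ _ (turn β β′) (word β′ βs ω)) ⟩
        (t + s) + owns ω                                   ≡⟨ +-assoc t s (owns ω) ⟩
        t + (s + owns ω)                                   ≡⟨ cong (t +_) (occA vs path) ⟩
        t + (n + owns β′)                                  ≡⟨ cong (t +_) (+-comm n (owns β′)) ⟩
        t + (owns β′ + n)                                  ≡⟨ +-assoc t (owns β′) n ⟨
        (t + owns β′) + n                                  ≡⟨ cong (_+ n) (occA-turn {β} {β′} v apart) ⟩
        1 + owns β + n                                     ≡⟨ cong suc (+-comm (owns β) n) ⟩
        1 + n + owns β                                     ∎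
        where
        open ≡-Reasoning
        t = occ (inj₁ a) (turn β β′)
        s = occ (inj₁ a) (word β′ βs ω)
        n = length (β′ ∷ βs)

    uniform : ∀ {β βs} → All (Valid E) (β ∷ βs) → Path β βs β →
              Uniform (length (β ∷ βs)) (word β βs β)
    -- The word closes up at its first block, so the corrections at the two ends coincide and
    -- cancel.
    uniform {β} vs path (inj₁ a) = +-cancelʳ-≡ (owns a β) _ _ (occA a vs path)
    uniform     vs path (inj₂ b) = occB b vs

-- Lists of A-letters split into pairs.

flatten : ∀ {m} → List (Fin m × Fin m) → List (Fin m)
flatten []             = []
flatten ((x , y) ∷ es) = x ∷ y ∷ flatten es

module _ {m : ℕ} where

  ∈-flatten⁻ : ∀ {a : Fin m} es → a ∈ flatten es → Any (a ∈ₑ_) es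
  ∈-flatten⁻ (e ∷ es) (here a≡)          = here (inj₁ a≡)
  ∈-flatten⁻ (e ∷ es) (there (here a≡))  = here (inj₂ a≡)
  ∈-flatten⁻ (e ∷ es) (there (there a∈)) = there (∈-flatten⁻ es a∈)

  ∈-flatten⁺ : ∀ {a : Fin m} {e es} → e ∈ es → a ∈ₑ e → a ∈ flatten es
  ∈-flatten⁺ (here refl) (inj₁ a≡) = here a≡
  ∈-flatten⁺ (here refl) (inj₂ a≡) = there (here a≡)
  ∈-flatten⁺ (there e∈)  a∈        = there (there (∈-flatten⁺ e∈ a∈))

  flatten-distinct : ∀ {es : List (Fin m × Fin m)} → Unique (flatten es) →
                     All (λ e → proj₁ e ≢ proj₂ e) es
  flatten-distinct {[]}     _                     = []
  flatten-distinct {e ∷ es} ((x≢y ∷ _) ∷ _ ∷ es!) = x≢y ∷ flatten-distinct es!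

  flatten-apart : ∀ {es : List (Fin m × Fin m)} → Unique (flatten es) → AllPairs Apart es
  flatten-apart {[]}     _ = []
  flatten-apart {e ∷ es} ((_ ∷ x∉) ∷ y∉ ∷ es!) =
    All.tabulate (λ e′∈ → λ { (inj₁ refl) a∈ → All.lookup x∉ (∈-flatten⁺ e′∈ a∈) refl
                            ; (inj₂ refl) a∈ → All.lookup y∉ (∈-flatten⁺ e′∈ a∈) refl })
    ∷ flatten-apart es!

  -- The result keeps the order inside the pair, on which the clash for free pairs depends.
  filter-flatten : ∀ {P : Fin m → Set} (P? : Decidable P) {e es} → Unique (flatten es) → e ∈ es →
                   P (proj₁ e) → P (proj₂ e) → (∀ {z} → P z → z ∈ₑ e) →
                   filter P? (flatten es) ≡ proj₁ e ∷ proj₂ e ∷ []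
  filter-flatten P? {es = (x , y) ∷ es} ((_ ∷ x∉) ∷ y∉ ∷ _) (here refl) px py only =
    trans (filter-accept P? px) (cong (x ∷_) (trans (filter-accept P? py) (cong (y ∷_)
      (filter-none P? (All.tabulate λ z∈ pz →
        [ (λ z≡x → All.lookup x∉ z∈ (sym z≡x)) , (λ z≡y → All.lookup y∉ z∈ (sym z≡y)) ]′ (only pz))))))
  filter-flatten P? {es = (x , y) ∷ es} ((_ ∷ x∉) ∷ y∉ ∷ es!) (there e∈) px py only =
    trans (filter-reject P? λ px′ → All.lookup x∉ (∈-flatten⁺ e∈ (only px′)) refl)
      (trans (filter-reject P? λ py′ → All.lookup y∉ (∈-flatten⁺ e∈ (only py′)) refl)
        (filter-flatten P? es! e∈ px py only))

  unflatten : ∀ n (xs : List (Fin m)) → length xs ≡ 2 * n → ∃[ es ] (flatten es ≡ xs × length es ≡ n)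
  unflatten zero    []           _  = [] , refl , refl
  unflatten (suc n) []           eq = contradiction (trans eq (*-suc 2 n)) λ ()
  unflatten (suc n) (x ∷ [])     eq = contradiction (suc-injective (trans eq (*-suc 2 n))) λ ()
  unflatten (suc n) (x ∷ y ∷ xs) eq
    with unflatten n xs (suc-injective (suc-injective (trans eq (*-suc 2 n))))
  ... | es , refl , refl = (x , y) ∷ es , refl , refl

-- Gaps that encode adjacency.

-- The classes are numbered so that class t belongs in gap t + 1 of `p q p q`. Gap 0, like gap 4,
-- lies inside neither letter and stays empty.
class : Bool → Bool → Fin 4
class true  false = 0F
class true  true  = 1F
class false true  = 2F
class false false = 3F

-- The first argument is adjacency to the inner letter u of `y u u y`, the second to the outer
-- letter y. For a chain this counts the letters of the pair not adjacent to b.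
defect : Bool → Bool → Fin 3
defect true  _     = 0F
defect false true  = 1F
defect false false = 2F

class-inside₁ : ∀ e f → e ≡ inside₁ false (suc (class e f))
class-inside₁ true  true  = refl
class-inside₁ true  false = refl
class-inside₁ false true  = refl
class-inside₁ false false = refl

class-inside₂ : ∀ e f → f ≡ inside₂ false (suc (class e f))
class-inside₂ true  true  = refl
class-inside₂ true  false = refl
class-inside₂ false true  = refl
class-inside₂ false false = refl

defect-inside₁ : ∀ s e f → (T e → T f) → f ≡ inside₁ true (leave s (defect e f))
defect-inside₁ _     true  true  _   = refl
-- Every gap between the two u's lies between the two y's, so `y u u y` has no place for a b
-- adjacent to u only; the chain excludes it.
defect-inside₁ _     true  false e⇒f = ⊥-elim (e⇒f _)
defect-inside₁ true  false true  _   = refl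
defect-inside₁ true  false false _   = refl
defect-inside₁ false false true  _   = refl
defect-inside₁ false false false _   = refl

defect-inside₂ : ∀ s e f → e ≡ inside₂ true (leave s (defect e f))
defect-inside₂ _     true  _     = refl
defect-inside₂ true  false true  = refl
defect-inside₂ true  false false = refl
defect-inside₂ false false true  = refl
defect-inside₂ false false false = refl

-- The representing word and its non-edges.

module _ {m p : ℕ} (E : Fin m → Fin p → Bool) where

  word-head : ∀ β βs (ω : Block {m} {p}) → ∃[ v ] word β βs ω ≡ zoneOf β ++ v
  word-head β []        ω = mid β ω , refl
  word-head β (β′ ∷ βs) ω = mid β β′ ++ word β′ βs ω , ++-assoc (zoneOf β) (mid β β′) _

  filter-turn : ∀ {P : V m p → Set} (P? : Decidable P) β β′ v {z w u} →
    filter P? (zoneOf β) ≡ z → filter P? (mid β β′) ≡ w → filter P? v ≡ u →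
    filter P? (turn β β′ ++ v) ≡ z ++ w ++ u
  filter-turn P? β β′ v refl refl refl = trans (filter-++ P? (turn β β′) v)
    (trans (cong (_++ filter P? v) (filter-++ P? (zoneOf β) (mid β β′)))
      (++-assoc (filter P? (zoneOf β)) (filter P? (mid β β′)) (filter P? v)))

  -- In the zone that owns `a` the letter occurs twice and `a′` not at all, so the restriction there
  -- is `a a`.
  word-nonalternating : ∀ {β βs ω} {γ : Block} → γ ∈ β ∷ βs → Valid E γ →
    ∀ {a a′} → a ∈ₑ Block.ends γ → ¬ a′ ∈ₑ Block.ends γ → ¬ Alternate (inj₁ a) (inj₁ a′) (word β βs ω)
  word-nonalternating {βs = βs} {γ = γ} γ∈ v {a} {a′} a∈ a′∉ l = clash a∈ (Linked-zoneOf aa? βs γ∈ l)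
    where
    open Block γ
    open Valid v
    aa? : Decidable (λ (z : V m p) → z ≡ inj₁ a ⊎ z ≡ inj₁ a′)
    aa? z = (z ≟V inj₁ a) ⊎-dec (z ≟V inj₁ a′)
    noB : filter (aa? ∘ inj₂) orderB ≡ []
    noB = filter-empty (aa? ∘ inj₂) (λ { (inj₁ ()) ; (inj₂ ()) }) orderB
    repeat : ¬ Linked _≢_ (inj₁ {B = Fin p} a ∷ inj₁ a ∷ [])
    repeat (a≢a ∷ _) = a≢a refl
    clash : a ∈ₑ ends → ¬ Linked _≢_ (filter aa? (zoneOf γ))
    clash (inj₁ refl) = repeat ∘ subst (Linked _≢_) (trans
      (filter-zoneOf-x₁ aa? γ (inj₁ refl)
        (λ { (inj₁ refl) → x₁≢x₂ refl ; (inj₂ refl) → a′∉ (inj₂ refl) }) noB)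
      (solo₁-[] nested a gap))
    clash (inj₂ refl) = repeat ∘ subst (Linked _≢_) (trans
      (filter-zoneOf-x₂ aa? γ
        (λ { (inj₁ refl) → x₁≢x₂ refl ; (inj₂ refl) → a′∉ (inj₁ refl) }) (inj₁ refl) noB)
      (solo₂-[] nested a gap))

  module Construction
    (e₁ e₂ e₃ : Fin m × Fin m) (es : List (Fin m × Fin m))
    (es! : Unique (flatten (e₁ ∷ e₂ ∷ e₃ ∷ es)))
    (cover : ∀ a → a ∈ flatten (e₁ ∷ e₂ ∷ e₃ ∷ es))
    (chain₁ : ∀ b → T (E (proj₂ e₁) b) → T (E (proj₁ e₁) b))
    (chain₂ : ∀ b → T (E (proj₂ e₂) b) → T (E (proj₁ e₂) b))
    where

    open Block

    -- β₁ lists R backwards, the others forwards: this stops the two letters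
    -- of a free pair from alternating.
    R : List (Fin m)
    R = flatten (e₁ ∷ e₂ ∷ e₃ ∷ es)

    R-once : Once R
    R-once a = filter-single (_≟ a) es! (cover a) refl (λ _ → id)

    key : Fin p → Key
    key b = class (E (proj₁ e₃) b) (E (proj₂ e₃) b)
          , defect (E (proj₂ e₁) b) (E (proj₁ e₁) b)
          , defect (E (proj₂ e₂) b) (E (proj₁ e₂) b)

    open Orders key

    free : Fin m × Fin m → Block
    free e = block false e (λ b → suc (class (E (proj₁ e) b) (E (proj₂ e) b))) R (allFin p)

    -- The last fields are chosen so that, once sorted by gap, the B-letters of the three zones read
    -- `order₁`, `order₂` and `order₃`.
    β₁ β₂ β₃ : Block
    β₁ = block true  e₁ (gap₁ ∘ key) (reverse R) (base (allFin p))
    β₂ = block true  e₂ (gap₂ ∘ key) R (base (allFin p))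
    β₃ = block false e₃ (gap₃ ∘ key) R (reverse (order₁ (allFin p)))

    βs : List Block
    βs = map free es

    w : Word m p
    w = word β₁ (β₂ ∷ β₃ ∷ βs) β₁

    base-once : Once (base (allFin p))
    base-once = sortBy-once _ (allFin p) (allFin-once p)

    valid : All (Valid E) (β₁ ∷ β₂ ∷ β₃ ∷ βs)
    valid with flatten-distinct es!
    ... | d₁ ∷ d₂ ∷ d₃ ∷ ds =
      record { x₁≢x₂ = d₁
             ; edge₁ = λ b → defect-inside₁ (sign₁ (proj₁ (key b))) _ _ (chain₁ b)
             ; edge₂ = λ b → defect-inside₂ (sign₁ (proj₁ (key b))) _ _
             ; onceA = reverse-once R R-once
             ; onceB = base-once }
      ∷ record { x₁≢x₂ = d₂
               ; edge₁ = λ b → defect-inside₁ (sign₂ (proj₁ (key b))) _ _ (chain₂ b)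
               ; edge₂ = λ b → defect-inside₂ (sign₂ (proj₁ (key b))) _ _
               ; onceA = R-once
               ; onceB = base-once }
      ∷ record { x₁≢x₂ = d₃
               ; edge₁ = λ b → class-inside₁ _ _
               ; edge₂ = λ b → class-inside₂ _ _
               ; onceA = R-once
               ; onceB = reverse-once (order₁ (allFin p)) (sortBy-once _ (base (allFin p)) base-once) }
      ∷ AllP.map⁺ (All.map (λ d → record
               { x₁≢x₂ = d
               ; edge₁ = λ b → class-inside₁ _ _
               ; edge₂ = λ b → class-inside₂ _ _
               ; onceA = R-once
               ; onceB = allFin-once p }) ds)

    apart : AllPairs (λ β β′ → Apart (ends β) (ends β′)) (β₁ ∷ β₂ ∷ β₃ ∷ βs)
    apart with flatten-apart es!
    ... | (a₁₂ ∷ a₁₃ ∷ a₁) ∷ (a₂₃ ∷ a₂) ∷ a₃ ∷ as =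
      (a₁₂ ∷ a₁₃ ∷ AllP.map⁺ a₁) ∷ (a₂₃ ∷ AllP.map⁺ a₂) ∷ AllP.map⁺ a₃ ∷ AllPairsP.map⁺ as

    path : Path β₁ (β₂ ∷ β₃ ∷ βs) β₁
    path with apart
    ... | (a₁₂ ∷ a₁) ∷ rest = a₁₂ ∷ close _ rest (a₁₂ ∷ a₁)
      where
      close : ∀ {β ω} γs → AllPairs (λ β β′ → Apart (ends β) (ends β′)) (β ∷ γs) →
              All (λ β → Apart (ends ω) (ends β)) (β ∷ γs) → Path β γs ω
      -- All pairs are mutually disjoint, so the last one is also apart from the first.
      close []       _                     (ωβ ∷ _) = last (λ ∈β ∈ω → ωβ ∈ω ∈β)
      close (γ ∷ γs) ((βγ ∷ _) ∷ pairwise) (_ ∷ ω)  = βγ ∷ close γs pairwise ω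

    own : ∀ a → ∃[ β ] (β ∈ β₁ ∷ β₂ ∷ β₃ ∷ βs × a ∈ₑ ends β)
    own a with ∈-flatten⁻ (e₁ ∷ e₂ ∷ e₃ ∷ es) (cover a)
    ... | here a∈                  = β₁ , here refl , a∈
    ... | there (here a∈)          = β₂ , there (here refl) , a∈
    ... | there (there (here a∈))  = β₃ , there (there (here refl)) , a∈
    ... | there (there (there a∈)) with find a∈
    ...   | e , e∈ , a∈e = free e , there (there (there (∈-map⁺ free e∈))) , a∈e

    module _ {P : V m p → Set} (P? : Decidable P) (noB : ∀ {b} → ¬ P (inj₂ b)) where

      private
        noB-filter : ∀ L → filter (P? ∘ inj₂) L ≡ []
        noB-filter = filter-empty (P? ∘ inj₂) noB

      nested-clash : ∀ {γ} → γ ∈ β₁ ∷ β₂ ∷ β₃ ∷ βs → nested γ ≡ true →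
        P (inj₁ (x₁ γ)) → P (inj₁ (x₂ γ)) → ¬ Linked _≢_ (filter P? w)
      nested-clash {γ@(block true _ _ _ L)} γ∈ refl p₁ p₂ l
        with subst (Linked _≢_) (filter-zoneOf-both P? γ p₁ p₂ (noB-filter L)) (Linked-zoneOf P? (β₂ ∷ β₃ ∷ βs) γ∈ l)
      ... | _ ∷ x₂≢x₂ ∷ _ = x₂≢x₂ refl

      -- M₁ shows `y x` because `β₁` lists `R` backwards, Z₂ shows neither letter, and the next
      -- letter shown is `x` again.
      free-clash : ∀ {e} → e ∈ e₃ ∷ es → P (inj₁ (proj₁ e)) → P (inj₁ (proj₂ e)) →
        (∀ {z} → P (inj₁ z) → z ∈ₑ e) → ¬ Linked _≢_ (filter P? w)
      free-clash {e@(x , y)} e∈ px py only l with flatten-apart es!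
      ... | (a₁₂ ∷ a₁) ∷ a₂ ∷ a₃ ∷ _ = third e∈
        where
        e⊥e₁ : Apart e₁ e
        e⊥e₁ = All.lookup a₁ e∈
        e⊥e₂ : Apart e₂ e
        e⊥e₂ = All.lookup a₂ e∈

        inR : filter (P? ∘ inj₁) R ≡ x ∷ y ∷ []
        inR = filter-flatten (P? ∘ inj₁) es! (there (there e∈)) px py only

        zone₁ : filter P? (zoneOf β₁) ≡ []
        zone₁ = filter-zoneOf-none P? β₁ (e⊥e₁ (inj₁ refl) ∘ only) (e⊥e₁ (inj₂ refl) ∘ only)
          (noB-filter (orderB β₁))
        zone₂ : filter P? (zoneOf β₂) ≡ []
        zone₂ = filter-zoneOf-none P? β₂ (e⊥e₂ (inj₁ refl) ∘ only) (e⊥e₂ (inj₂ refl) ∘ only)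
          (noB-filter (orderB β₂))

        mid₁ : filter P? (mid β₁ β₂) ≡ inj₁ y ∷ inj₁ x ∷ []
        mid₁ = trans (filter-mid P? β₁ β₂) (cong (map inj₁) (trans
          (cong (filter (outside? β₁ β₂)) (trans (filter-reverse (P? ∘ inj₁) R) (cong reverse inR)))
          (filter-all (outside? β₁ β₂)
            (((λ i → e⊥e₁ i (inj₂ refl)) , (λ i → e⊥e₂ i (inj₂ refl)))
            ∷ ((λ i → e⊥e₁ i (inj₁ refl)) , (λ i → e⊥e₂ i (inj₁ refl))) ∷ []))))

        tail : List (V m p)
        tail = filter P? (word β₃ βs β₁)

        whole : ∀ {u} → filter P? (mid β₂ β₃) ++ tail ≡ inj₁ x ∷ u → ⊥
        whole eq with subst (Linked _≢_) (filter-turn P? β₁ β₂ (turn β₂ β₃ ++ word β₃ βs β₁) zone₁ mid₁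
                        (trans (filter-turn P? β₂ β₃ (word β₃ βs β₁) zone₂ refl refl) eq)) l
        ... | _ ∷ x≢x ∷ _ = x≢x refl

        third : e ∈ e₃ ∷ es → ⊥
        -- M₂ omits the third pair; the repeated `x` opens Z₃, which reads `x y x y`.
        third (here refl) with word-head β₃ βs β₁
        ... | v , eq = whole (cong₂ _++_
          (trans (filter-mid P? β₂ β₃) (cong (map inj₁) (trans (cong (filter (outside? β₂ β₃)) inR)
            (filter-none (outside? β₂ β₃) ((λ o → proj₂ o (inj₁ refl)) ∷ (λ o → proj₂ o (inj₂ refl)) ∷ [])))))
          (trans (cong (filter P?) eq) (trans (filter-++ P? (zoneOf β₃) v)
            (cong (_++ filter P? v) (filter-zoneOf-both P? β₃ px py (noB-filter (orderB β₃)))))))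
        -- For any later pair M₂ itself reads `x y`.
        third (there e∈es) = whole (cong (_++ tail) (trans (filter-mid P? β₂ β₃) (cong (map inj₁)
          (trans (cong (filter (outside? β₂ β₃)) inR) (filter-all (outside? β₂ β₃)
            (((λ i → e⊥e₂ i (inj₁ refl)) , (λ i → All.lookup a₃ e∈es i (inj₁ refl)))
            ∷ ((λ i → e⊥e₂ i (inj₂ refl)) , (λ i → All.lookup a₃ e∈es i (inj₂ refl))) ∷ []))))))

      -- The predicate is left abstract because the two letters tested may come in either order
      -- relative to the pair of `γ`.
      pair-clash : ∀ {γ} → γ ∈ β₁ ∷ β₂ ∷ β₃ ∷ βs → P (inj₁ (x₁ γ)) → P (inj₁ (x₂ γ)) →
        (∀ {z} → P (inj₁ z) → z ∈ₑ ends γ) → ¬ Linked _≢_ (filter P? w)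
      pair-clash γ∈@(here refl)              p₁ p₂ _    = nested-clash γ∈ refl p₁ p₂
      pair-clash γ∈@(there (here refl))      p₁ p₂ _    = nested-clash γ∈ refl p₁ p₂
      pair-clash (there (there (here refl))) p₁ p₂ only = free-clash (here refl) p₁ p₂ only
      pair-clash (there (there (there γ∈)))  p₁ p₂ only with ∈-map⁻ free γ∈
      ... | e , e∈ , refl = free-clash (there e∈) p₁ p₂ only

    A-nonalternating : ∀ a a′ → a ≢ a′ → ¬ Alternate (inj₁ a) (inj₁ a′) w
    A-nonalternating a a′ a≢a′ l with own a
    ... | γ , γ∈ , a∈ with a′ ∈ₑ? ends γ
    ... | no a′∉ = word-nonalternating {ω = β₁} γ∈ (All.lookup valid γ∈) a∈ a′∉ l
    ... | yes a′∈ = same a∈ a′∈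
      where
      aa? : Decidable (λ (z : V m p) → z ≡ inj₁ a ⊎ z ≡ inj₁ a′)
      aa? z = (z ≟V inj₁ a) ⊎-dec (z ≟V inj₁ a′)
      only : ∀ {z} → inj₁ {B = Fin p} z ≡ inj₁ a ⊎ inj₁ {B = Fin p} z ≡ inj₁ a′ → z ∈ₑ ends γ
      only (inj₁ refl) = a∈
      only (inj₂ refl) = a′∈
      noB : ∀ {b : Fin p} → ¬ (inj₂ b ≡ inj₁ a ⊎ inj₂ b ≡ inj₁ a′)
      noB (inj₁ ())
      noB (inj₂ ())
      same : a ∈ₑ ends γ → a′ ∈ₑ ends γ → ⊥
      same (inj₁ refl) (inj₁ refl) = a≢a′ refl
      same (inj₁ refl) (inj₂ refl) = pair-clash aa? noB γ∈ (inj₁ refl) (inj₂ refl) only l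
      same (inj₂ refl) (inj₁ refl) = pair-clash aa? noB γ∈ (inj₂ refl) (inj₁ refl) only l
      same (inj₂ refl) (inj₂ refl) = a≢a′ refl

    -- The M's hold no B-letter, so the restricted word begins with a copy of `trace`, which already
    -- fails to alternate.
    B-nonalternating : ∀ b b′ → b ≢ b′ → ¬ Alternate (inj₂ b) (inj₂ b′) w
    B-nonalternating b b′ b≢b′ l =
      [ clash , clash ]′ (filter-double (bb? ∘ inj₂) (allFin⁺ p) b≢b′ (∈-allFin b) (∈-allFin b′)
        (inj₁ refl) (inj₂ refl) λ { (inj₁ refl) → inj₁ refl ; (inj₂ refl) → inj₂ refl })
      where
      bb? : Decidable (λ (z : V m p) → z ≡ inj₂ b ⊎ z ≡ inj₂ b′)
      bb? z = (z ≟V inj₂ b) ⊎-dec (z ≟V inj₂ b′)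

      noA : ∀ {a : Fin m} → ¬ (inj₁ a ≡ inj₂ b ⊎ inj₁ a ≡ inj₂ b′)
      noA (inj₁ ())
      noA (inj₂ ())

      zoneB : ∀ β {L} → filter (bb? ∘ inj₂) (sortBy (gap β) (orderB β)) ≡ L →
              filter bb? (zoneOf β) ≡ map inj₂ L
      zoneB β refl = trans (filter-zoneOf-none bb? β noA noA refl)
        (trans (zone-[] (gap β) (filter (bb? ∘ inj₂) (orderB β))) (cong (map inj₂) (sym (filter-sortBy (bb? ∘ inj₂) (gap β) (orderB β)))))

      midB : ∀ β β′ → filter bb? (mid β β′) ≡ []
      midB β β′ = trans (filter-mid bb? β β′) (cong (map inj₁ ∘ filter (outside? β β′))
        (filter-empty (bb? ∘ inj₁) noA (orderA β)))

      clash : ∀ {x y} → filter (bb? ∘ inj₂) (allFin p) ≡ x ∷ y ∷ [] → ⊥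
      clash {x} {y} eq with word-head β₃ βs β₁
      ... | v , head = trace-clash (key x) (key y)
        -- Letters that differ come from Booleans that differ, so alternation would carry back to
        -- the trace.
        (Linked.map (λ fx≢fy x≡y → fx≢fy (cong f x≡y))
          (Linked-map⁻ (Linked-++ˡ (map f (trace (key x) (key y))) (subst (Linked _≢_) restrict l))))
        where
        f : Bool → V m p
        f = inj₂ ∘ pick x y

        agree : ∀ z → key (pick x y z) ≡ pick (key x) (key y) z
        agree false = refl
        agree true  = refl

        module K = Orders (pick (key x) (key y))

        z₁ : filter bb? (zoneOf β₁) ≡ map inj₂ (map (pick x y) (K.order₁ pair))
        z₁ = zoneB β₁ (trans (filter-order₁ (bb? ∘ inj₂) (allFin p))
          (trans (cong order₁ eq) (map-order₁ (pick x y) key (pick (key x) (key y)) agree pair)))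
        z₂ : filter bb? (zoneOf β₂) ≡ map inj₂ (map (pick x y) (K.order₂ pair))
        z₂ = zoneB β₂ (trans (filter-order₂ (bb? ∘ inj₂) (allFin p))
          (trans (cong order₂ eq) (map-order₂ (pick x y) key (pick (key x) (key y)) agree pair)))
        z₃ : filter bb? (zoneOf β₃) ≡ map inj₂ (map (pick x y) (K.order₃ pair))
        z₃ = zoneB β₃ (trans (filter-order₃ (bb? ∘ inj₂) (allFin p))
          (trans (cong order₃ eq) (map-order₃ (pick x y) key (pick (key x) (key y)) agree pair)))

        restrict : filter bb? w ≡ map f (trace (key x) (key y)) ++ filter bb? v
        restrict = begin
          filter bb? w
            ≡⟨ filter-turn bb? β₁ β₂ (turn β₂ β₃ ++ word β₃ βs β₁) z₁ (midB β₁ β₂)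
                 (filter-turn bb? β₂ β₃ (word β₃ βs β₁) z₂ (midB β₂ β₃)
                   (trans (cong (filter bb?) head) (trans (filter-++ bb? (zoneOf β₃) v) (cong (_++ _) z₃)))) ⟩
          g o₁ ++ g o₂ ++ g o₃ ++ rest      ≡⟨ cong (g o₁ ++_) (++-assoc (g o₂) (g o₃) rest) ⟨
          g o₁ ++ (g o₂ ++ g o₃) ++ rest    ≡⟨ ++-assoc (g o₁) (g o₂ ++ g o₃) rest ⟨
          (g o₁ ++ g o₂ ++ g o₃) ++ rest
            ≡⟨ cong (_++ rest) (cong₂ _++_ (sym (map-∘ o₁)) (cong₂ _++_ (sym (map-∘ o₂)) (sym (map-∘ o₃)))) ⟩
          (map f o₁ ++ map f o₂ ++ map f o₃) ++ rest
            ≡⟨ cong (λ t → (map f o₁ ++ t) ++ rest) (map-++ f o₂ o₃) ⟨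
          (map f o₁ ++ map f (o₂ ++ o₃)) ++ rest
            ≡⟨ cong (_++ rest) (map-++ f o₁ (o₂ ++ o₃)) ⟨
          map f (o₁ ++ o₂ ++ o₃) ++ rest ∎
          where
          open ≡-Reasoning
          g = map inj₂ ∘ map (pick x y)
          o₁ = K.order₁ pair
          o₂ = K.order₂ pair
          o₃ = K.order₃ pair
          rest = filter bb? v

    AB-alternating : ∀ a b → T (E a b) ⇔ Alternate (inj₁ a) (inj₂ b) w
    AB-alternating a b = mk⇔
      -- The tail removes `before β₁`, the letter put in front for the induction.
      (λ e → Linked.tail (word-alternates valid (Equivalence.to T-≡ e) path))
      (λ l → far l (E a b) refl)
      where
      open Edges E a b
      far : Alternate (inj₁ a) (inj₂ b) w → ∀ e → E a b ≡ e → T e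
      far l true  _ = _
      far l false e with own a
      ... | γ , γ∈ , a∈ = zone-far (All.lookup valid γ∈) a∈ e (Linked-zoneOf ab? (β₂ ∷ β₃ ∷ βs) γ∈ l)

    occurs : ∀ v → v ∈ w
    -- An empty restriction is impossible, since uniformity gives one occurrence per block and there
    -- are at least three blocks.
    occurs v with filter (_≟V v) w in eq | uniform valid path v
    ... | z ∷ _ | _ with ∈-filter⁻ (_≟V v) {xs = w} (subst (z ∈_) (sym eq) (here refl))
    ... | z∈ , refl = z∈

    represents : Represents E w
    represents = occurs , adjacent
      where
      swap : ∀ x y → Alternate x y w → Alternate y x w
      swap x y = subst (Linked _≢_)
        (filter-≐ (λ z → (z ≟V x) ⊎-dec (z ≟V y)) (λ z → (z ≟V y) ⊎-dec (z ≟V x)) (Sum.swap , Sum.swap) w)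
      adjacent : ∀ x y → x ≢ y → Adj E x y ⇔ Alternate x y w
      adjacent (inj₁ a) (inj₁ a′) x≢y = mk⇔ ⊥-elim (A-nonalternating a a′ (x≢y ∘ cong inj₁))
      adjacent (inj₂ b) (inj₂ b′) x≢y = mk⇔ ⊥-elim (B-nonalternating b b′ (x≢y ∘ cong inj₂))
      adjacent (inj₁ a) (inj₂ b)  _   = AB-alternating a b
      adjacent (inj₂ b) (inj₁ a)  _   = mk⇔
        (swap (inj₁ a) (inj₂ b) ∘ Equivalence.to (AB-alternating a b))
        (Equivalence.from (AB-alternating a b) ∘ swap (inj₂ b) (inj₁ a))

  -- From the two chains to the pairs.

  Chain₂ : List (Fin m) → Set
  Chain₂ c = ∃[ y ] ∃[ u ] (y ≢ u × (∀ b → T (E u b) → T (E y b)) × y ∈ c × u ∈ c)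

  -- Orients the chain: the larger neighbourhood comes first and becomes the outer letter of
  -- `y u u y`.
  chain₂ : ∀ c → IsChain E c → length c ≡ 2 → Chain₂ c
  chain₂ (x ∷ y ∷ []) (((x≢y ∷ []) ∷ _) , comparable) refl
    with comparable x y (here refl) (there (here refl))
  ... | inj₁ x≼y = y , x , x≢y ∘ sym , (λ b → x≼y (inj₂ b)) , there (here refl) , here refl
  ... | inj₂ y≼x = x , y , x≢y       , (λ b → y≼x (inj₂ b)) , here refl , there (here refl)

  representable : ∀ k y₁ u₁ y₂ u₂ rest → 3 ≤ k →
    length (y₁ ∷ u₁ ∷ y₂ ∷ u₂ ∷ rest) ≡ 2 * k →
    Unique (y₁ ∷ u₁ ∷ y₂ ∷ u₂ ∷ rest) → (∀ a → a ∈ y₁ ∷ u₁ ∷ y₂ ∷ u₂ ∷ rest) →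
    (∀ b → T (E u₁ b) → T (E y₁ b)) → (∀ b → T (E u₂ b) → T (E y₂ b)) → RLe E k
  representable k y₁ u₁ y₂ u₂ rest 3≤k len xs! cover chain₁ chain₂
    with unflatten k (y₁ ∷ u₁ ∷ y₂ ∷ u₂ ∷ rest) len
  -- The bound on `k` yields a third pair, and the first `refl` identifies `e₁` and `e₂` with the
  -- two chains.
  representable _ y₁ u₁ y₂ u₂ _ (s≤s (s≤s (s≤s _))) len xs! cover chain₁ chain₂
    | e₁ ∷ e₂ ∷ e₃ ∷ es , refl , refl =
    -- The number of pairs is `k` itself, so the bound is met with equality.
    3 + length es , ≤-refl , w ,
    subst (λ n → Uniform n w) (cong (3 +_) (length-map free es)) (uniform valid path) , represents
    where open Construction e₁ e₂ e₃ es xs! cover chain₁ chain₂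

-- Two lists without repetition and with the same members are permutations of each other; the other
-- list here is `allFin m`.
length-enumeration : ∀ {m} {xs : List (Fin m)} → Unique xs → (∀ a → a ∈ xs) → length xs ≡ m
length-enumeration {m} xs! cover = trans
  (↭-length (∼bag⇒↭ (unique∧set⇒bag xs! (allFin⁺ m) (mk⇔ (λ _ → ∈-allFin _) (λ _ → cover _)))))
  (length-tabulate id)

complement : ∀ {m} (xs : List (Fin m)) → Unique xs →
             ∃[ ys ] (Unique (xs ++ ys) × (∀ a → a ∈ xs ++ ys))
complement {m} xs xs! = ys , UniqueP.++⁺ xs! (UniqueP.filter⁺ new? (allFin⁺ m)) disjoint , cover
  where
  new? = λ a → ¬? (_∈?_ _≟_ a xs)
  ys = filter new? (allFin m)
  disjoint : ∀ {a} → ¬ (a ∈ xs × a ∈ ys)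
  disjoint (a∈xs , a∈ys) = proj₂ (∈-filter⁻ new? {xs = allFin m} a∈ys) a∈xs
  cover : ∀ a → a ∈ xs ++ ys
  cover a with _∈?_ _≟_ a xs
  ... | yes a∈ = ∈-++⁺ˡ a∈
  ... | no  a∉ = ∈-++⁺ʳ xs (∈-filter⁺ new? (∈-allFin a) a∉)

theorem5 : (m p k : ℕ) (E : Fin m → Fin p → Bool) →
    m ≤ p → m ≡ 2 * k → 3 ≤ k →
    Connected E → Reduced E →
    HeightA E 2 → TwoDisjoint2Chains E →
    RLe E k
theorem5 m p k E _ m≡2k 3≤k _ _ _ (c₁ , c₂ , ch₁ , len₁ , ch₂ , len₂ , disjoint)
  with chain₂ E c₁ ch₁ len₁ | chain₂ E c₂ ch₂ len₂
... | y₁ , u₁ , y₁≢u₁ , u₁≼y₁ , y₁∈ , u₁∈ | y₂ , u₂ , y₂≢u₂ , u₂≼y₂ , y₂∈ , u₂∈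
  -- The four chain letters head the enumeration of A, so cutting it into consecutive pairs keeps
  -- both chains intact.
  with complement (y₁ ∷ u₁ ∷ y₂ ∷ u₂ ∷ [])
         ((y₁≢u₁ ∷ across y₁∈ y₂∈ ∷ across y₁∈ u₂∈ ∷ [])
         ∷ (across u₁∈ y₂∈ ∷ across u₁∈ u₂∈ ∷ [])
         ∷ (y₂≢u₂ ∷ []) ∷ [] ∷ [])
  where
  across : ∀ {a a′} → a ∈ c₁ → a′ ∈ c₂ → a ≢ a′
  across a∈ a′∈ refl = disjoint _ a∈ a′∈
... | rest , xs! , cover =
  representable E k y₁ u₁ y₂ u₂ rest 3≤k (trans (length-enumeration xs! cover) m≡2k) xs! cover u₁≼y₁ u₂≼y₂
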